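{- Let $G$ be a connected non-bipartite graph and $\Gamma=(G,\sigma)$ a signed graph on $G$. Then $\Gamma\in\mathbb{FS}_1(G)$ if and only if $\Gamma$ is switching isomorphic to a signed graph $\tilde\Gamma$ of the following form. For some integers $s\ge1$ and $0\le m\le s$, the vertex set of $\tilde\Gamma$ is a disjoint union of blocks $\Omega_1,\Omega_2,U_{11},U_{21},U_{12},U_{22},\ldots,U_{1s},U_{2s}$ with $\Omega_1\cup\Omega_2\ne\emptyset$ and $|U_{1j}|=|U_{2j}|$, and the blocks of the symmetric matrix $A(\tilde\Gamma)$ (in suitable orderings of the blocks) are: - $\Omega_1\times\Omega_1$ and $\Omega_2\times\Omega_2$: $0$; $\Omega_1\times\Omega_2$: $A$; - for $1\le j\le m$: $\Omega_1\times U_{1j}$: $D_{1j}$; $\Omega_1\times U_{2j}$: $D_{1j}$; $\Omega_2\times U_{1j}$: $D_{2j}$; $\Omega_2\times U_{2j}$: $-D_{2j}$; - for $m+1\le j\le s$: $\Omega_1\times U_{1j}$: $D_{1j}$; $\Omega_1\times U_{2j}$: $-D_{1j}$; $\Omega_2\times U_{1j}$: $D_{2j}$; $\Omega_2\times U_{2j}$: $D_{2j}$; - for $1\le j\le s$: $(U_{1j}\cup U_{2j})\times(U_{1j}\cup U_{2j})$: $\begin{pmatrix}B_j&Y_j\\-Y_j&-B_j\end{pmatrix}$; - for $j\ne k$: $(U_{1j}\cup U_{2j})\times(U_{1k}\cup U_{2k})$: $0$; where $A$, $D_{1j}$, $D_{2j}$, $B_j$, $Y_j$ are matrices with entries in $\{0,1,-1\}$,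 $B_j$ is symmetric with zero diagonal, and $Y_j^\top=-Y_j$ for $j=1,\ldots,s$.
   Context: Graphs are finite and simple. A signed graph $\Gamma=(G,\sigma)$ on $G$ is $G$ with a function $\sigma:E(G)\to\{+1,-1\}$; its adjacency matrix $A(\Gamma)$ has $(u,v)$-entry $\sigma(uv)$ if $uv\in E(G)$ and $0$ otherwise. Switching $\Gamma$ with respect to $U\subseteq V(G)$ reverses the signs of all edges between $U$ and $V(G)\setminus U$. $\Gamma\simeq\Gamma'$ (switching isomorphic) means $\Gamma$ is isomorphic, by a sign-preserving graph isomorphism, to a switching of $\Gamma'$. $\Gamma$ is sign-symmetric if $\Gamma\simeq-\Gamma=(G,-\sigma)$. The sign of a cycle is the product of the signs of its edges. A weak automorphism of $\Gamma$ is a $\varphi\in Aut(G)$ with $\sigma(\varphi(C))=-\sigma(C)$ for every odd cycle $C$ of $G$ and $\sigma(\varphi(C))=\sigma(C)$ for every even cycle $C$. It is principal if it has the smallest order among all weak automorphisms of $\Gamma$. $\mathbb{S}_1(G)$ is the set of sign-symmetric signed graphs on $G$ having a principal weak automorphism of order $2$; for such $\varphi$, $F=\{v\in V(G)\mid\varphi(v)=v\}$. $\mathbb{FS}_1(G)$ is the set of $\Gamma\in\mathbb{S}_1(G)$ with $F\neq\emptyset$, i.e. having a principal weak automorphism of order $2$ with at least one fixed vertex. One of $\Omega_1,\Omega_2$ may be empty. -}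

module Defs where

open import Data.Bool using (Bool; true; false; T; if_then_else_; _xor_)
open import Data.Bool.Properties using (xor-comm)
open import Data.Fin using (Fin; toℕ)
open import Data.Fin.Permutation using (Permutation; Permutation′; _⟨$⟩ʳ_)
open import Data.Fin.Subset using (Subset)
open import Data.Integer using (ℤ; 0ℤ; 1ℤ; -1ℤ; -_; _◃_)
open import Data.List using (List; []; _∷_; length)
open import Data.List.Relation.Unary.Unique.Propositional using (Unique)
open import Data.Nat using (ℕ; _+_; _≤_; _<_)
open import Data.Nat.Divisibility using (_∣_; _∤_)
open import Data.Nat.GeneralisedArithmetic using (iterate)
open import Data.Product using (Σ-syntax; ∃-syntax; _×_)
open import Data.Sign using (Sign; opposite)
import Data.Sign as Sign
open import Data.Sum using (_⊎_)
open import Data.Unit using (tt)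
open import Data.Vec using (lookup)
open import Function.Bundles using (_↔_; _⇔_; Inverse; module Equivalence)
open import Level using (0ℓ)
open import Relation.Binary using (Rel)
open import Relation.Binary.Construct.Closure.ReflexiveTransitive using (Star; ε; _◅_; gmap)
open import Relation.Binary.PropositionalEquality using (_≡_; _≢_; cong; cong₂)

record Graph (n : ℕ) : Set where
  field
    adjacent    : Fin n → Fin n → Bool
    symmetric   : ∀ u v → adjacent u v ≡ adjacent v u
    irreflexive : ∀ v → adjacent v v ≡ false

  infix 4 _~_
  _~_ : Fin n → Fin n → Set
  u ~ v = T (adjacent u v)

Walk : ∀ {n} → Graph n → Fin n → Fin n → Set
Walk G = Star (Graph._~_ G)

Connected : ∀ {n} → Graph n → Set
Connected G = ∀ u v → Walk G u v

Bipartite : ∀ {n} → Graph n → Set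
Bipartite {n} G = Σ[ colour ∈ (Fin n → Bool) ] (∀ u v → u ~ v → colour u ≢ colour v)
  where open Graph G

-- The start vertex of every step, so the final vertex is not repeated for a closed walk.
vertices : ∀ {n} {_~_ : Rel (Fin n) 0ℓ} {u v} → Star _~_ u v → List (Fin n)
vertices ε             = []
vertices (_◅_ {u} _ w) = u ∷ vertices w

edgeCount : ∀ {n} {_~_ : Rel (Fin n) 0ℓ} {u v} → Star _~_ u v → ℕ
edgeCount w = length (vertices w)

-- A cycle is given with a base vertex and an orientation; neither affects its
-- length or its sign.
IsCycle : ∀ {n} {_~_ : Rel (Fin n) 0ℓ} {v} → Star _~_ v v → Set
IsCycle C = 3 ≤ edgeCount C × Unique (vertices C)

IsGraphIso : ∀ {m n} → Graph m → Graph n → Permutation m n → Set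
IsGraphIso G H f = ∀ u v → (u ~G v) ⇔ ((f ⟨$⟩ʳ u) ~H (f ⟨$⟩ʳ v))
  where open Graph G renaming (_~_ to _~G_)
        open Graph H renaming (_~_ to _~H_)

IsAut : ∀ {n} → Graph n → Permutation′ n → Set
IsAut G φ = IsGraphIso G G φ

imageWalk : ∀ {m n} (G : Graph m) (H : Graph n) (f : Permutation m n) → IsGraphIso G H f →
            ∀ {u v} → Walk G u v → Walk H (f ⟨$⟩ʳ u) (f ⟨$⟩ʳ v)
imageWalk G H f iso = gmap (f ⟨$⟩ʳ_) (λ {u} {v} → Equivalence.to (iso u v))

record SignedGraph {n : ℕ} (G : Graph n) : Set where
  open Graph G
  field
    σ     : ∀ u v → u ~ v → Sign
    σ-sym : ∀ u v (e : u ~ v) (e′ : v ~ u) → σ u v e ≡ σ v u e′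

Matrix : ℕ → ℕ → Set
Matrix k l = Fin k → Fin l → ℤ

entry : (b : Bool) → (T b → Sign) → ℤ
entry true  s = s tt ◃ 1
entry false _ = 0ℤ

adjacencyMatrix : ∀ {n} {G : Graph n} → SignedGraph G → Matrix n n
adjacencyMatrix {G = G} Γ u v = entry (Graph.adjacent G u v) (SignedGraph.σ Γ u v)

neg : ∀ {n} {G : Graph n} → SignedGraph G → SignedGraph G
neg Γ = record
  { σ     = λ u v e → opposite (σ u v e)
  ; σ-sym = λ u v e e′ → cong opposite (σ-sym u v e e′)
  } where open SignedGraph Γ

reverseIf : Bool → Sign → Sign
reverseIf b s = if b then opposite s else s

switch : ∀ {n} {G : Graph n} → Subset n → SignedGraph G → SignedGraph G
switch U Γ = record
  { σ     = λ u v e → reverseIf (lookup U u xor lookup U v) (σ u v e)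
  ; σ-sym = λ u v e e′ → cong₂ reverseIf (xor-comm (lookup U u) (lookup U v)) (σ-sym u v e e′)
  } where open SignedGraph Γ

infix 4 _≅_ _≃_

record _≅_ {m n} {G : Graph m} {H : Graph n} (Γ : SignedGraph G) (Δ : SignedGraph H) : Set where
  field
    iso       : Permutation m n
    graphIso  : IsGraphIso G H iso
    preserves : ∀ u v e → SignedGraph.σ Δ (iso ⟨$⟩ʳ u) (iso ⟨$⟩ʳ v) (Equivalence.to (graphIso u v) e)
                          ≡ SignedGraph.σ Γ u v e

_≃_ : ∀ {m n} {G : Graph m} {H : Graph n} → SignedGraph G → SignedGraph H → Set
_≃_ {n = n} Γ Δ = Σ[ U ∈ Subset n ] Γ ≅ switch U Δ

SignSymmetric : ∀ {n} {G : Graph n} → SignedGraph G → Set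
SignSymmetric Γ = Γ ≃ neg Γ

walkSign : ∀ {n} {G : Graph n} → SignedGraph G → ∀ {u v} → Walk G u v → Sign
walkSign Γ ε                 = Sign.+
walkSign Γ (_◅_ {u} {v} e w) = SignedGraph.σ Γ u v e Sign.* walkSign Γ w

record IsWeakAut {n} {G : Graph n} (Γ : SignedGraph G) (φ : Permutation′ n) : Set where
  field
    isAut : IsAut G φ
    odd   : ∀ {v} (C : Walk G v v) → IsCycle C → 2 ∤ edgeCount C →
            walkSign Γ (imageWalk G G φ isAut C) ≡ opposite (walkSign Γ C)
    even  : ∀ {v} (C : Walk G v v) → IsCycle C → 2 ∣ edgeCount C →
            walkSign Γ (imageWalk G G φ isAut C) ≡ walkSign Γ C

PowerIsId : ∀ {n} → Permutation′ n → ℕ → Set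
PowerIsId φ k = ∀ v → iterate (φ ⟨$⟩ʳ_) v k ≡ v

record HasOrder {n} (φ : Permutation′ n) (k : ℕ) : Set where
  field
    positive : 1 ≤ k
    power    : PowerIsId φ k
    least    : ∀ j → 1 ≤ j → PowerIsId φ j → k ≤ j

record IsPrincipalOfOrder {n} {G : Graph n} (Γ : SignedGraph G) (φ : Permutation′ n) (k : ℕ) : Set where
  field
    isWeakAut : IsWeakAut Γ φ
    hasOrder  : HasOrder φ k
    minimal   : ∀ ψ l → IsWeakAut Γ ψ → HasOrder ψ l → k ≤ l

𝕊₁ : ∀ {n} (G : Graph n) → SignedGraph G → Set
𝕊₁ {n} G Γ = SignSymmetric Γ × Σ[ φ ∈ Permutation′ n ] IsPrincipalOfOrder Γ φ 2

𝔽𝕊₁ : ∀ {n} (G : Graph n) → SignedGraph G → Set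
𝔽𝕊₁ {n} G Γ = 𝕊₁ G Γ ×
  Σ[ φ ∈ Permutation′ n ] IsPrincipalOfOrder Γ φ 2 × (∃[ v ] φ ⟨$⟩ʳ v ≡ v)

IsSignEntry : ℤ → Set
IsSignEntry x = x ≡ 0ℤ ⊎ x ≡ 1ℤ ⊎ x ≡ -1ℤ

SignMatrix : ∀ {k l} → Matrix k l → Set
SignMatrix M = ∀ x y → IsSignEntry (M x y)

data Position (a b s : ℕ) (r : Fin s → ℕ) : Set where
  ω₁ : Fin a → Position a b s r
  ω₂ : Fin b → Position a b s r
  u₁ : (j : Fin s) → Fin (r j) → Position a b s r
  u₂ : (j : Fin s) → Fin (r j) → Position a b s r

-- a = |Ω₁|, b = |Ω₂|, r j = |U₁ⱼ| = |U₂ⱼ|, and `place` is the decomposition of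
-- the vertex set into ordered blocks. The index j : Fin s counts from 0, so the
-- blocks 1 ≤ j ≤ m are those with toℕ j < m. Only Ω₁ or Ω₂ may be empty.
-- The blocks U × Ω and Ω₂ × Ω₁ are determined by symmetry of the adjacency matrix.
record BlockForm {n} {G : Graph n} (Γ : SignedGraph G) : Set where
  field
    s m : ℕ
    1≤s : 1 ≤ s
    m≤s : m ≤ s

    a b        : ℕ
    r          : Fin s → ℕ
    Ω-nonempty : 1 ≤ a + b
    U-nonempty : ∀ j → 1 ≤ r j
    place      : Position a b s r ↔ Fin n

    A     : Matrix a b
    D₁    : ∀ j → Matrix a (r j)
    D₂    : ∀ j → Matrix b (r j)
    B Y   : ∀ j → Matrix (r j) (r j)

    A-sign  : SignMatrix A
    D₁-sign : ∀ j → SignMatrix (D₁ j)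
    D₂-sign : ∀ j → SignMatrix (D₂ j)
    B-sign  : ∀ j → SignMatrix (B j)
    Y-sign  : ∀ j → SignMatrix (Y j)

    B-symmetric    : ∀ j x y → B j y x ≡ B j x y
    B-zeroDiagonal : ∀ j x → B j x x ≡ 0ℤ
    Y-skew         : ∀ j x y → Y j y x ≡ - Y j x y

  M : Position a b s r → Position a b s r → ℤ
  M p q = adjacencyMatrix Γ (Inverse.to place p) (Inverse.to place q)

  field
    Ω₁Ω₁ : ∀ x y → M (ω₁ x) (ω₁ y) ≡ 0ℤ
    Ω₂Ω₂ : ∀ x y → M (ω₂ x) (ω₂ y) ≡ 0ℤ
    Ω₁Ω₂ : ∀ x y → M (ω₁ x) (ω₂ y) ≡ A x y

    low-Ω₁U₁ : ∀ j → toℕ j < m → ∀ x y → M (ω₁ x) (u₁ j y) ≡ D₁ j x y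
    low-Ω₁U₂ : ∀ j → toℕ j < m → ∀ x y → M (ω₁ x) (u₂ j y) ≡ D₁ j x y
    low-Ω₂U₁ : ∀ j → toℕ j < m → ∀ x y → M (ω₂ x) (u₁ j y) ≡ D₂ j x y
    low-Ω₂U₂ : ∀ j → toℕ j < m → ∀ x y → M (ω₂ x) (u₂ j y) ≡ - D₂ j x y

    high-Ω₁U₁ : ∀ j → m ≤ toℕ j → ∀ x y → M (ω₁ x) (u₁ j y) ≡ D₁ j x y
    high-Ω₁U₂ : ∀ j → m ≤ toℕ j → ∀ x y → M (ω₁ x) (u₂ j y) ≡ - D₁ j x y
    high-Ω₂U₁ : ∀ j → m ≤ toℕ j → ∀ x y → M (ω₂ x) (u₁ j y) ≡ D₂ j x y
    high-Ω₂U₂ : ∀ j → m ≤ toℕ j → ∀ x y → M (ω₂ x) (u₂ j y) ≡ D₂ j x y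

    U₁U₁ : ∀ j x y → M (u₁ j x) (u₁ j y) ≡ B j x y
    U₁U₂ : ∀ j x y → M (u₁ j x) (u₂ j y) ≡ Y j x y
    U₂U₁ : ∀ j x y → M (u₂ j x) (u₁ j y) ≡ - Y j x y
    U₂U₂ : ∀ j x y → M (u₂ j x) (u₂ j y) ≡ - B j x y

    off-U₁U₁ : ∀ j k → j ≢ k → ∀ x y → M (u₁ j x) (u₁ k y) ≡ 0ℤ
    off-U₁U₂ : ∀ j k → j ≢ k → ∀ x y → M (u₁ j x) (u₂ k y) ≡ 0ℤ
    off-U₂U₁ : ∀ j k → j ≢ k → ∀ x y → M (u₂ j x) (u₁ k y) ≡ 0ℤ
    off-U₂U₂ : ∀ j k → j ≢ k → ∀ x y → M (u₂ j x) (u₂ k y) ≡ 0ℤ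

{-# OPTIONS --safe #-}
module Submission where

-- Call an adjacency matrix similar to another along f if f turns one into the other up to conjugation
-- by a diagonal sign matrix θ; then Γ ≃ Δ iff Γ is similar to Δ along a permutation. A permutation φ
-- is a weak automorphism of a connected Γ iff Γ is similar to −Γ along φ: the signature
-- −σ(uv)σ(φu φv) is positive on every cycle, and erasing loops from closed walks shows that such a
-- signature is θ(u)θ(v). If φ is an involution with a fixed vertex, then θ is φ-invariant, so switching
-- makes θ trivial off the fixed vertices; the signs of θ on the fixed vertices give Ω₁ and Ω₂, and one
-- vertex from each 2-cycle gives U₁. Conversely the exchange of the U₁ⱼ with the U₂ⱼ is such an
-- involution, and the identity is not a weak automorphism, as θ would be a proper 2-colouring.

open import Defs
open import Data.Bool using (Bool; true; false; T; _xor_; if_then_else_)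
open import Data.Bool.Properties using (T-irrelevant)
open import Data.Empty using (⊥-elim)
open import Data.Fin using (Fin; zero; suc; toℕ; fromℕ<; splitAt; _<_)
open import Data.Fin.Permutation
  using (Permutation; Permutation′; _⟨$⟩ʳ_; _⟨$⟩ˡ_; inverseˡ; inverseʳ; permutation; flip; _∘ₚ_)
import Data.Fin.Permutation as Perm
open import Data.Fin.Properties using (_≟_; <-cmp; <-asym; <-irrefl; _<?_; ¬∀⟶∃¬)
open import Data.Integer using (ℤ; +_; 0ℤ; -_)
open import Data.Integer.Properties using (neg-involutive)
open import Data.List using (List; []; _∷_; _++_; length; filter; allFin)
import Data.List as List
open import Data.List.Membership.Propositional.Properties using (∈-filter⁺; ∈-filter⁻; ∈-allFin; ∈-lookup)
open import Data.List.Relation.Unary.All using (All; []; _∷_)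
import Data.List.Relation.Unary.All as All
import Data.List.Relation.Unary.All.Properties as All
open import Data.List.Relation.Unary.AllPairs using ([]; _∷_)
import Data.List.Relation.Unary.AllPairs as AllPairs
open import Data.List.Relation.Unary.Any using (index)
open import Data.List.Relation.Unary.Any.Properties using (lookup-index)
open import Data.List.Relation.Unary.Unique.Propositional using (Unique)
open import Data.List.Relation.Unary.Unique.Propositional.Properties using (filter⁺; allFin⁺)
open import Data.Nat using (ℕ; zero; suc; z≤n; s≤s; _≤_)
import Data.Nat as ℕ
import Data.Nat.Properties as ℕ
open import Data.Nat.Divisibility using (_∣_; _∤_; _∣0; ∣-refl; ∣m∣n⇒∣m+n; ∣m+n∣m⇒∣n; ∣1⇒≡1; _∣?_)
open import Data.Product using (Σ-syntax; ∃-syntax; _×_; _,_; proj₁; proj₂)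
import Data.Sign as Sign
open import Data.Sign using (Sign; opposite) renaming (_*_ to _⊗_; + to ⊕; - to ⊖)
open import Data.Sign.Properties
  using (s≢opposite[s]; s*s≡+; *-assoc; *-comm; *-identityʳ; opposite-involutive; *-commutativeSemigroup)
open import Algebra.Properties.CommutativeSemigroup *-commutativeSemigroup using (interchange)
open import Data.Sum using (_⊎_; inj₁; inj₂)
open import Data.Unit using (tt)
open import Data.Vec using (lookup; tabulate)
open import Data.Vec.Properties using (lookup∘tabulate)
open import Function using (_∘_; id)
open import Function.Bundles using (_↔_; _⇔_; Inverse; mk⇔; mk↔ₛ′; module Equivalence)
open import Level using (0ℓ)
open import Relation.Binary using (Rel; tri<; tri≈; tri>)
open import Relation.Binary.Construct.Closure.ReflexiveTransitive using (Star; ε; _◅_; _◅◅_)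
open import Relation.Binary.PropositionalEquality
open import Relation.Nullary using (¬_; Dec; does; yes; no; contradiction)
open import Relation.Nullary.Decidable using (_×-dec_; dec-true; dec-false)
open import Relation.Unary using (Decidable)

open ≡-Reasoning

private variable
  m n   : ℕ
  G H K : Graph n

-- Signs acting on integers and on matrix entries.

infixr 7 _·_

_·_ : Sign → ℤ → ℤ
⊕ · x = x
⊖ · x = - x

·-assoc : ∀ s t x → (s ⊗ t) · x ≡ s · t · x
·-assoc ⊕ t x = refl
·-assoc ⊖ ⊕ x = refl
·-assoc ⊖ ⊖ x = sym (neg-involutive x)

⊗-cancelled : ∀ {s t} → s ⊗ t ≡ ⊕ → s ≡ t
⊗-cancelled {⊕} {⊕} _ = refl
⊗-cancelled {⊖} {⊖} _ = refl

⊗-transpose : ∀ {s} t {r} → r ≡ s ⊗ t → s ≡ r ⊗ t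
⊗-transpose {s} t refl = begin
  s            ≡⟨ *-identityʳ s ⟨
  s ⊗ ⊕        ≡⟨ cong (s ⊗_) (s*s≡+ t) ⟨
  s ⊗ (t ⊗ t)  ≡⟨ *-assoc s t t ⟨
  (s ⊗ t) ⊗ t  ∎

entry-cong : ∀ {b b′} {s : T b → Sign} {s′ : T b′ → Sign} t → (T b → T b′) → (T b′ → T b) →
             (∀ e e′ → s′ e′ ≡ t ⊗ s e) → entry b′ s′ ≡ t · entry b s
entry-cong {false} {false} ⊕ f g h = refl
entry-cong {false} {false} ⊖ f g h = refl
entry-cong {false} {true}  t f g h = ⊥-elim (g tt)
entry-cong {true}  {false} t f g h = ⊥-elim (f tt)
entry-cong {true}  {true} {s} {s′} t f g h rewrite h tt tt with t | s tt
... | ⊕ | _ = refl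
... | ⊖ | ⊕ = refl
... | ⊖ | ⊖ = refl

-- An entry vanishes exactly at a non-edge, and multiplication by a sign never turns a zero into a
-- nonzero entry or back.
entry-support : ∀ {b b′} {s : T b → Sign} {s′ : T b′ → Sign} t →
                entry b′ s′ ≡ t · entry b s → b ≡ b′
entry-support {false} {false} t eq = refl
entry-support {true}  {true}  t eq = refl
entry-support {false} {true} {s′ = s′} t eq with s′ tt | t
entry-support {false} {true} t () | ⊕ | ⊕
entry-support {false} {true} t () | ⊕ | ⊖
entry-support {false} {true} t () | ⊖ | ⊕
entry-support {false} {true} t () | ⊖ | ⊖
entry-support {true} {false} {s = s} t eq with s tt | t
entry-support {true} {false} t () | ⊕ | ⊕
entry-support {true} {false} t () | ⊕ | ⊖
entry-support {true} {false} t () | ⊖ | ⊕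
entry-support {true} {false} t () | ⊖ | ⊖

entry-sign : ∀ {b b′} {s : T b → Sign} {s′ : T b′ → Sign} t →
             entry b′ s′ ≡ t · entry b s → ∀ e e′ → s′ e′ ≡ t ⊗ s e
entry-sign {true} {true} {s} {s′} t eq tt tt with s tt | s′ tt | t
... | ⊕ | ⊕ | ⊕ = refl
... | ⊕ | ⊖ | ⊖ = refl
... | ⊖ | ⊕ | ⊖ = refl
... | ⊖ | ⊖ | ⊕ = refl
entry-sign {true} {true} t () tt tt | ⊕ | ⊕ | ⊖
entry-sign {true} {true} t () tt tt | ⊕ | ⊖ | ⊕
entry-sign {true} {true} t () tt tt | ⊖ | ⊕ | ⊕
entry-sign {true} {true} t () tt tt | ⊖ | ⊖ | ⊖

entry-signEntry : ∀ b (s : T b → Sign) → IsSignEntry (entry b s)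
entry-signEntry false s = inj₁ refl
entry-signEntry true s with s tt
... | ⊕ = inj₂ (inj₁ refl)
... | ⊖ = inj₂ (inj₂ refl)

-- Adjacency matrices up to a vertex map and diagonal signs.

record Similar {G : Graph m} {H : Graph n} (Γ : SignedGraph G) (Δ : SignedGraph H)
               (f : Fin m → Fin n) (θ : Fin m → Sign) : Set where
  constructor similar
  field
    apply : ∀ u v → adjacencyMatrix Δ (f u) (f v) ≡ (θ u ⊗ θ v) · adjacencyMatrix Γ u v

open Similar

module _ {Γ : SignedGraph G} {Δ : SignedGraph H} {Λ : SignedGraph K} where

  -- Conjugations compose: the diagonal matrices multiply, the second one pulled back along `f`.
  similar-trans : ∀ {f g θ η} → Similar Γ Δ f θ → Similar Δ Λ g η →
                  Similar Γ Λ (g ∘ f) (λ u → η (f u) ⊗ θ u)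
  similar-trans {f} {g} {θ} {η} (similar p) (similar q) = similar λ u v → begin
    adjacencyMatrix Λ (g (f u)) (g (f v))                               ≡⟨ q (f u) (f v) ⟩
    (η (f u) ⊗ η (f v)) · adjacencyMatrix Δ (f u) (f v)
      ≡⟨ cong ((η (f u) ⊗ η (f v)) ·_) (p u v) ⟩
    (η (f u) ⊗ η (f v)) · (θ u ⊗ θ v) · adjacencyMatrix Γ u v
      ≡⟨ ·-assoc (η (f u) ⊗ η (f v)) _ _ ⟨
    ((η (f u) ⊗ η (f v)) ⊗ (θ u ⊗ θ v)) · adjacencyMatrix Γ u v
      ≡⟨ cong (_· adjacencyMatrix Γ u v) (interchange (η (f u)) _ _ _) ⟩
    ((η (f u) ⊗ θ u) ⊗ (η (f v) ⊗ θ v)) · adjacencyMatrix Γ u v         ∎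

module _ {G : Graph m} {H : Graph n} {Γ : SignedGraph G} {Δ : SignedGraph H} where

  -- A diagonal sign matrix is its own inverse, so the same signs, read at the preimage, undo the
  -- conjugation.
  similar-sym : ∀ {θ} (f : Permutation m n) → Similar Γ Δ (f ⟨$⟩ʳ_) θ →
                Similar Δ Γ (f ⟨$⟩ˡ_) (θ ∘ (f ⟨$⟩ˡ_))
  similar-sym {θ} f (similar p) = similar λ u v → let u′ = f ⟨$⟩ˡ u ; v′ = f ⟨$⟩ˡ v in begin
    adjacencyMatrix Γ u′ v′
      ≡⟨ cong (_· adjacencyMatrix Γ u′ v′) (s*s≡+ (θ u′ ⊗ θ v′)) ⟨
    ((θ u′ ⊗ θ v′) ⊗ (θ u′ ⊗ θ v′)) · adjacencyMatrix Γ u′ v′ ≡⟨ ·-assoc (θ u′ ⊗ θ v′) _ _ ⟩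
    (θ u′ ⊗ θ v′) · (θ u′ ⊗ θ v′) · adjacencyMatrix Γ u′ v′   ≡⟨ cong ((θ u′ ⊗ θ v′) ·_) (p u′ v′) ⟨
    (θ u′ ⊗ θ v′) · adjacencyMatrix Δ (f ⟨$⟩ʳ u′) (f ⟨$⟩ʳ v′)
      ≡⟨ cong ((θ u′ ⊗ θ v′) ·_) (cong₂ (adjacencyMatrix Δ) (inverseʳ f) (inverseʳ f)) ⟩
    (θ u′ ⊗ θ v′) · adjacencyMatrix Δ u v                 ∎

  similar⇒graphIso : ∀ {θ} (f : Permutation m n) → Similar Γ Δ (f ⟨$⟩ʳ_) θ → IsGraphIso G H f
  similar⇒graphIso {θ} f (similar p) u v = mk⇔ (subst T eq) (subst T (sym eq))
    where eq = entry-support (θ u ⊗ θ v) (p u v)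

adjacencyMatrix-neg : (Γ : SignedGraph G) → ∀ u v → adjacencyMatrix (neg Γ) u v ≡ - adjacencyMatrix Γ u v
adjacencyMatrix-neg Γ u v = entry-cong {s = SignedGraph.σ Γ u v} ⊖ id id
  (λ e e′ → cong (opposite ∘ SignedGraph.σ Γ u v) (T-irrelevant e′ e))

adjacencyMatrix-sym : (Γ : SignedGraph G) → ∀ u v → adjacencyMatrix Γ v u ≡ adjacencyMatrix Γ u v
adjacencyMatrix-sym {G = G} Γ u v = entry-cong {s = SignedGraph.σ Γ u v} ⊕
  (subst T (Graph.symmetric G u v)) (subst T (Graph.symmetric G v u))
  (λ e e′ → SignedGraph.σ-sym Γ v u e′ e)

neg-· : ∀ s x → - (s · x) ≡ opposite s · x
neg-· ⊕ x = refl
neg-· ⊖ x = neg-involutive x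

neg-·-comm : ∀ s x → - (s · x) ≡ s · (- x)
neg-·-comm ⊕ x = refl
neg-·-comm ⊖ x = refl

-- Lets a similarity from `Γ` to `neg Γ` be composed with itself, or be conjugated by a similarity
-- of `Γ` to another signed graph.
similar-neg : {Γ : SignedGraph G} {Δ : SignedGraph H} → ∀ {f θ} →
              Similar Γ Δ f θ → Similar (neg Γ) (neg Δ) f θ
similar-neg {Γ = Γ} {Δ} {f} {θ} (similar p) = similar λ u v → begin
  adjacencyMatrix (neg Δ) (f u) (f v)         ≡⟨ adjacencyMatrix-neg Δ (f u) (f v) ⟩
  - adjacencyMatrix Δ (f u) (f v)             ≡⟨ cong -_ (p u v) ⟩
  - ((θ u ⊗ θ v) · adjacencyMatrix Γ u v)     ≡⟨ neg-·-comm (θ u ⊗ θ v) _ ⟩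
  (θ u ⊗ θ v) · (- adjacencyMatrix Γ u v)     ≡⟨ cong ((θ u ⊗ θ v) ·_) (adjacencyMatrix-neg Γ u v) ⟨
  (θ u ⊗ θ v) · adjacencyMatrix (neg Γ) u v   ∎

-- Switching as conjugation by diagonal signs.

sideSign : Bool → Sign
sideSign true  = ⊖
sideSign false = ⊕

isNegative : Sign → Bool
isNegative ⊕ = false
isNegative ⊖ = true

sideSign-isNegative : ∀ s → sideSign (isNegative s) ≡ s
sideSign-isNegative ⊕ = refl
sideSign-isNegative ⊖ = refl

-- `sideSign` turns exclusive or into multiplication, so the reversal across the boundary of a set
-- splits into one factor for each end of the edge.
reverseIf-xor : ∀ a b s → reverseIf (a xor b) s ≡ (sideSign a ⊗ sideSign b) ⊗ s
reverseIf-xor true  true  s = refl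
reverseIf-xor true  false s = refl
reverseIf-xor false true  s = refl
reverseIf-xor false false s = refl

similar-switch : ∀ (Γ : SignedGraph G) U → Similar (switch U Γ) Γ id (sideSign ∘ lookup U)
similar-switch Γ U = similar λ u v →
  entry-cong {s = SignedGraph.σ (switch U Γ) u v}
    (sideSign (lookup U u) ⊗ sideSign (lookup U v)) id id (eq u v)
  where
  eq : ∀ u v e e′ → SignedGraph.σ Γ u v e′ ≡
       (sideSign (lookup U u) ⊗ sideSign (lookup U v)) ⊗ SignedGraph.σ (switch U Γ) u v e
  eq u v e e′ = let a = sideSign (lookup U u) ; b = sideSign (lookup U v) in begin
    SignedGraph.σ Γ u v e′
      ≡⟨ cong (SignedGraph.σ Γ u v) (T-irrelevant e′ e) ⟩
    SignedGraph.σ Γ u v e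
      ≡⟨ cong (_⊗ SignedGraph.σ Γ u v e) (s*s≡+ (a ⊗ b)) ⟨
    ((a ⊗ b) ⊗ (a ⊗ b)) ⊗ SignedGraph.σ Γ u v e         ≡⟨ *-assoc (a ⊗ b) _ _ ⟩
    (a ⊗ b) ⊗ ((a ⊗ b) ⊗ SignedGraph.σ Γ u v e)
      ≡⟨ cong ((a ⊗ b) ⊗_) (reverseIf-xor (lookup U u) (lookup U v) _) ⟨
    (a ⊗ b) ⊗ SignedGraph.σ (switch U Γ) u v e          ∎

module _ {G : Graph m} {H : Graph n} {Γ : SignedGraph G} {Δ : SignedGraph H} where

  ≃⇒similar : Γ ≃ Δ → Σ[ f ∈ Permutation m n ] ∃[ θ ] Similar Γ Δ (f ⟨$⟩ʳ_) θ
  ≃⇒similar (U , Γ≅) = iso , _ ,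
    similar-trans isometric (similar-switch Δ U)
    where
    open _≅_ Γ≅
    isometric : Similar Γ (switch U Δ) (iso ⟨$⟩ʳ_) (λ _ → ⊕)
    isometric = similar λ u v → entry-cong {s = SignedGraph.σ Γ u v} ⊕
      (Equivalence.to (graphIso u v)) (Equivalence.from (graphIso u v))
      λ e e′ → trans (cong (SignedGraph.σ (switch U Δ) _ _) (T-irrelevant e′ _)) (preserves u v e)

  similar⇒≃ : ∀ (f : Permutation m n) {θ} → Similar Γ Δ (f ⟨$⟩ʳ_) θ → Γ ≃ Δ
  similar⇒≃ f {θ} p@(similar p′) = U , record
    { iso       = f
    ; graphIso  = isoΓΔ
    ; preserves = λ u v e → begin
        reverseIf (lookup U (f ⟨$⟩ʳ u) xor lookup U (f ⟨$⟩ʳ v)) (SignedGraph.σ Δ _ _ (to′ u v e))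
          ≡⟨ reverseIf-xor (lookup U (f ⟨$⟩ʳ u)) _ _ ⟩
        (sideSign (lookup U (f ⟨$⟩ʳ u)) ⊗ sideSign (lookup U (f ⟨$⟩ʳ v))) ⊗ SignedGraph.σ Δ _ _ (to′ u v e)
          ≡⟨ cong₂ _⊗_ (cong₂ _⊗_ (U-sign u) (U-sign v)) (entry-sign (θ u ⊗ θ v) (p′ u v) e (to′ u v e)) ⟩
        (θ u ⊗ θ v) ⊗ ((θ u ⊗ θ v) ⊗ SignedGraph.σ Γ u v e)
          ≡⟨ *-assoc (θ u ⊗ θ v) _ _ ⟨
        ((θ u ⊗ θ v) ⊗ (θ u ⊗ θ v)) ⊗ SignedGraph.σ Γ u v e
          ≡⟨ cong (_⊗ SignedGraph.σ Γ u v e) (s*s≡+ (θ u ⊗ θ v)) ⟩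
        SignedGraph.σ Γ u v e ∎
    }
    where
    -- `θ` lives on the source while `≃` switches the target, so the set of negative vertices is
    -- carried along `f`.
    U = tabulate (isNegative ∘ θ ∘ (f ⟨$⟩ˡ_))
    isoΓΔ : IsGraphIso G H f
    isoΓΔ = similar⇒graphIso f p
    to′ : ∀ u v → _
    to′ u v = Equivalence.to (isoΓΔ u v)
    U-sign : ∀ u → sideSign (lookup U (f ⟨$⟩ʳ u)) ≡ θ u
    U-sign u = begin
      sideSign (lookup U (f ⟨$⟩ʳ u))                 ≡⟨ cong sideSign (lookup∘tabulate _ (f ⟨$⟩ʳ u)) ⟩
      sideSign (isNegative (θ (f ⟨$⟩ˡ (f ⟨$⟩ʳ u))))  ≡⟨ sideSign-isNegative _ ⟩
      θ (f ⟨$⟩ˡ (f ⟨$⟩ʳ u))                          ≡⟨ cong θ (inverseˡ f) ⟩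
      θ u                                            ∎

-- Balanced signed graphs

vertices-◅◅ : ∀ {_~_ : Rel (Fin n) 0ℓ} {u v w} (p : Star _~_ u v) (q : Star _~_ v w) →
              vertices (p ◅◅ q) ≡ vertices p ++ vertices q
vertices-◅◅ ε       q = refl
vertices-◅◅ (e ◅ p) q = cong (_ ∷_) (vertices-◅◅ p q)

walkSign-◅◅ : (Γ : SignedGraph G) → ∀ {u v w} (p : Walk G u v) (q : Walk G v w) →
              walkSign Γ (p ◅◅ q) ≡ walkSign Γ p ⊗ walkSign Γ q
walkSign-◅◅ Γ ε       q = refl
walkSign-◅◅ Γ (e ◅ p) q = trans (cong (SignedGraph.σ Γ _ _ e ⊗_) (walkSign-◅◅ Γ p q))
                                   (sym (*-assoc (SignedGraph.σ Γ _ _ e) _ _))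

unique-++⁻ : ∀ {A : Set} (xs : List A) {ys} → Unique (xs ++ ys) → Unique xs × Unique ys
unique-++⁻ []       !ys        = [] , !ys
unique-++⁻ (x ∷ xs) (x∉ ∷ !xs) with unique-++⁻ xs !xs
... | !xs′ , !ys = All.++⁻ˡ xs x∉ ∷ !xs′ , !ys

-- `vertices` leaves out the final vertex, so `v` is put back: a path may not pass through its end
-- earlier.
IsPath : ∀ {_~_ : Rel (Fin n) 0ℓ} {u v} → Star _~_ u v → Set
IsPath {v = v} p = Unique (v ∷ vertices p)

-- The index `p ◅◅ q` makes a match on `visit` cut the walk itself at `x`.
data FirstVisit {_~_ : Rel (Fin n) 0ℓ} {u v} (x : Fin n) : Star _~_ u v → Set where
  visit : (p : Star _~_ u x) (q : Star _~_ x v) → All (x ≢_) (vertices p) → FirstVisit x (p ◅◅ q)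

firstVisit? : ∀ {_~_ : Rel (Fin n) 0ℓ} {u v} (x : Fin n) (p : Star _~_ u v) →
              FirstVisit x p ⊎ All (x ≢_) (v ∷ vertices p)
firstVisit? {u = u} x p with x ≟ u
... | yes refl = inj₁ (visit ε p [])
firstVisit? x ε       | no x≢u = inj₂ (x≢u ∷ [])
firstVisit? x (e ◅ p) | no x≢u with firstVisit? x p
... | inj₁ (visit q r x∉q) = inj₁ (visit (e ◅ q) r (x≢u ∷ x∉q))
... | inj₂ (x≢v ∷ x∉p)     = inj₂ (x≢v ∷ x≢u ∷ x∉p)

-- Balance in the sense of Harary; `balanced` below is his characterisation for connected graphs.
CyclesPositive : {G : Graph n} → SignedGraph G → Set
CyclesPositive {G = G} Δ = ∀ {v} (C : Walk G v v) → IsCycle C → walkSign Δ C ≡ ⊕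

module _ {G : Graph n} (Δ : SignedGraph G) (positive : CyclesPositive Δ) where
  open SignedGraph Δ

  -- The closed walks too short to be cycles: length one would be a loop, and length two runs along
  -- an edge and back, which squares its sign.
  closed-positive : ∀ {v} (C : Walk G v v) → Unique (vertices C) → walkSign Δ C ≡ ⊕
  closed-positive ε _ = refl
  closed-positive {v} (e ◅ ε) _ = ⊥-elim (subst T (Graph.irreflexive G v) e)
  closed-positive (_◅_ {u} e (_◅_ {v} e′ ε)) _ = begin
    σ u v e ⊗ (σ v u e′ ⊗ ⊕)  ≡⟨ cong (σ u v e ⊗_) (*-identityʳ (σ v u e′)) ⟩
    σ u v e ⊗ σ v u e′        ≡⟨ cong (_⊗ σ v u e′) (σ-sym u v e e′) ⟩
    σ v u e′ ⊗ σ v u e′       ≡⟨ s*s≡+ (σ v u e′) ⟩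
    ⊕                         ∎
  closed-positive C@(_ ◅ _ ◅ _ ◅ _) !C = positive C (s≤s (s≤s (s≤s z≤n)) , !C)

  loopErasure : ∀ {u v} (w : Walk G u v) → Σ[ p ∈ Walk G u v ] IsPath p × walkSign Δ w ≡ walkSign Δ p
  loopErasure ε = ε , [] ∷ [] , refl
  loopErasure {u} {v} (_◅_ {_} {x} e w) with loopErasure w
  ... | p , !p , w≡p with firstVisit? u p
  ... | inj₂ (u≢v ∷ u∉p) =
    e ◅ p , ((u≢v ∘ sym) ∷ AllPairs.head !p) ∷ (u∉p ∷ AllPairs.tail !p) , cong (σ u x e ⊗_) w≡p
  ... | inj₁ (visit q r u∉q) with subst (λ xs → Unique (v ∷ xs)) (vertices-◅◅ q r) !p
  ... | v∉ ∷ !qr with unique-++⁻ (vertices q) !qr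
  ... | !q , !r = r , All.++⁻ʳ (vertices q) v∉ ∷ !r , (begin
    σ u x e ⊗ walkSign Δ w                      ≡⟨ cong (σ u x e ⊗_) w≡p ⟩
    σ u x e ⊗ walkSign Δ (q ◅◅ r)               ≡⟨ walkSign-◅◅ Δ (e ◅ q) r ⟩
    walkSign Δ (e ◅ q) ⊗ walkSign Δ r
      ≡⟨ cong (_⊗ walkSign Δ r) (closed-positive (e ◅ q) (u∉q ∷ !q)) ⟩
    walkSign Δ r                                ∎)

  closedWalk-positive : ∀ {v} (w : Walk G v v) → walkSign Δ w ≡ ⊕
  closedWalk-positive w with loopErasure w
  ... | ε     , _                , w≡p = w≡p
  -- A nonempty path cannot end where it starts.
  ... | e ◅ _ , (v≢v ∷ _) ∷ _    , _   = contradiction refl v≢v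

-- The potential `θ u` is the sign of a chosen walk from the root `zero` to `u`. Closing this walk
-- up, directly or through an edge, gives positive closed walks that relate the potentials of
-- neighbours. The graph without vertices has no root and is treated apart.
balanced : ∀ {n} {G : Graph n} (Δ : SignedGraph G) → CyclesPositive Δ → Connected G →
           Σ[ θ ∈ (Fin n → Sign) ] (∀ u v e → SignedGraph.σ Δ u v e ≡ θ u ⊗ θ v)
balanced {zero}  Δ positive conn = (λ ()) , λ ()
balanced {suc n} Δ positive conn = θ , λ u v e → ⊗-transpose (θ v) (begin
  θ u                                                     ≡⟨ ⊗-cancelled (roundTrip u v e) ⟩
  SignedGraph.σ Δ u v e ⊗ walkSign Δ (conn v zero)
    ≡⟨ cong (SignedGraph.σ Δ u v e ⊗_) (⊗-cancelled (closed v)) ⟨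
  SignedGraph.σ Δ u v e ⊗ θ v                             ∎)
  where
  θ : Fin (suc n) → Sign
  θ u = walkSign Δ (conn zero u)
  closed : ∀ u → θ u ⊗ walkSign Δ (conn u zero) ≡ ⊕
  closed u = trans (sym (walkSign-◅◅ Δ (conn zero u) (conn u zero)))
                   (closedWalk-positive Δ positive (conn zero u ◅◅ conn u zero))
  roundTrip : ∀ u v e → θ u ⊗ (SignedGraph.σ Δ u v e ⊗ walkSign Δ (conn v zero)) ≡ ⊕
  roundTrip u v e = trans (sym (walkSign-◅◅ Δ (conn zero u) (e ◅ conn v zero)))
                          (closedWalk-positive Δ positive (conn zero u ◅◅ e ◅ conn v zero))

-- Weak automorphisms

-- The sign at every inner vertex of the walk occurs twice and cancels.
walkSign-coboundary : (Δ : SignedGraph G) (θ : Fin _ → Sign) →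
                      (∀ u v e → SignedGraph.σ Δ u v e ≡ θ u ⊗ θ v) →
                      ∀ {u v} (w : Walk G u v) → walkSign Δ w ≡ θ u ⊗ θ v
walkSign-coboundary Δ θ σ≡ {u} ε = sym (s*s≡+ (θ u))
walkSign-coboundary Δ θ σ≡ {u} {v} (_◅_ {_} {x} e w) = begin
  SignedGraph.σ Δ u x e ⊗ walkSign Δ w  ≡⟨ cong₂ _⊗_ (σ≡ u x e) (walkSign-coboundary Δ θ σ≡ w) ⟩
  (θ u ⊗ θ x) ⊗ (θ x ⊗ θ v)             ≡⟨ *-assoc (θ u) _ _ ⟩
  θ u ⊗ (θ x ⊗ (θ x ⊗ θ v))             ≡⟨ cong (θ u ⊗_) (*-assoc (θ x) _ _) ⟨
  θ u ⊗ ((θ x ⊗ θ x) ⊗ θ v)             ≡⟨ cong (λ s → θ u ⊗ (s ⊗ θ v)) (s*s≡+ (θ x)) ⟩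
  θ u ⊗ θ v                             ∎

alternating : ℕ → Sign
alternating zero    = ⊕
alternating (suc n) = opposite (alternating n)

alternating-even : ∀ n → 2 ∣ n → alternating n ≡ ⊕
alternating-even zero          _     = refl
alternating-even (suc zero)    2∣1   = contradiction (∣1⇒≡1 2∣1) λ ()
alternating-even (suc (suc n)) 2∣2+n =
  trans (opposite-involutive _) (alternating-even n (∣m+n∣m⇒∣n 2∣2+n ∣-refl))

alternating-odd : ∀ n → 2 ∤ n → alternating n ≡ ⊖
alternating-odd zero          2∤0   = contradiction (2 ∣0) 2∤0
alternating-odd (suc zero)    _     = refl
alternating-odd (suc (suc n)) 2∤2+n =
  trans (opposite-involutive _) (alternating-odd n (2∤2+n ∘ ∣m∣n⇒∣m+n ∣-refl))

⊗-opposite : ∀ s t → s ⊗ opposite t ≡ opposite (s ⊗ t)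
⊗-opposite ⊕ t = refl
⊗-opposite ⊖ t = refl

opposite-⊗ : ∀ s t → opposite s ⊗ t ≡ opposite (s ⊗ t)
opposite-⊗ ⊕ t = refl
opposite-⊗ ⊖ t = sym (opposite-involutive t)

module _ {n} {G : Graph n} (Γ : SignedGraph G) (φ : Permutation′ n) where
  open SignedGraph Γ

  -- φ is a weak automorphism iff every cycle is positive here.
  distortion : IsAut G φ → SignedGraph G
  distortion aut = record
    { σ     = λ u v e → opposite (σ u v e ⊗ σ _ _ (Equivalence.to (aut u v) e))
    ; σ-sym = λ u v e e′ → cong opposite (cong₂ _⊗_ (σ-sym u v e e′) (σ-sym _ _ _ _))
    }

  -- Each edge contributes a factor -1, so the parity of the length enters through `alternating`.
  walkSign-distortion : ∀ aut {u v} (w : Walk G u v) → walkSign (distortion aut) w ≡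
    alternating (edgeCount w) ⊗ (walkSign Γ w ⊗ walkSign Γ (imageWalk G G φ aut w))
  walkSign-distortion aut ε = refl
  walkSign-distortion aut (_◅_ {u} {x} e w) = begin
    opposite (s ⊗ s′) ⊗ walkSign (distortion aut) w
      ≡⟨ cong (opposite (s ⊗ s′) ⊗_) (walkSign-distortion aut w) ⟩
    opposite (s ⊗ s′) ⊗ (c ⊗ (t ⊗ t′))               ≡⟨ opposite-⊗ (s ⊗ s′) _ ⟩
    opposite ((s ⊗ s′) ⊗ (c ⊗ (t ⊗ t′)))             ≡⟨ cong opposite (interchange s s′ c _) ⟩
    opposite ((s ⊗ c) ⊗ (s′ ⊗ (t ⊗ t′)))
      ≡⟨ cong (λ r → opposite (r ⊗ (s′ ⊗ (t ⊗ t′)))) (*-comm s c) ⟩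
    opposite ((c ⊗ s) ⊗ (s′ ⊗ (t ⊗ t′)))             ≡⟨ cong opposite (*-assoc c s _) ⟩
    opposite (c ⊗ (s ⊗ (s′ ⊗ (t ⊗ t′))))             ≡⟨ cong (λ r → opposite (c ⊗ r)) (*-assoc s s′ _) ⟨
    opposite (c ⊗ ((s ⊗ s′) ⊗ (t ⊗ t′)))
      ≡⟨ cong (λ r → opposite (c ⊗ r)) (interchange s s′ t t′) ⟩
    opposite (c ⊗ ((s ⊗ t) ⊗ (s′ ⊗ t′)))             ≡⟨ opposite-⊗ c _ ⟨
    opposite c ⊗ ((s ⊗ t) ⊗ (s′ ⊗ t′))               ∎
    where
    s  = σ u x e
    s′ = σ _ _ (Equivalence.to (aut u x) e)
    t  = walkSign Γ w
    t′ = walkSign Γ (imageWalk G G φ aut w)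
    c  = alternating (edgeCount w)

  -- The factor (-1)^length compensates the sign change that a weak automorphism causes on odd
  -- cycles only.
  distortion-positive : (wa : IsWeakAut Γ φ) → CyclesPositive (distortion (IsWeakAut.isAut wa))
  distortion-positive wa C isC = trans (walkSign-distortion isAut C) (case (2 ∣? edgeCount C))
    where
    open IsWeakAut wa
    t  = walkSign Γ C
    t′ = walkSign Γ (imageWalk G G φ isAut C)
    case : Dec (2 ∣ edgeCount C) → alternating (edgeCount C) ⊗ (t ⊗ t′) ≡ ⊕
    case (yes 2∣) rewrite alternating-even (edgeCount C) 2∣ | even C isC 2∣ = s*s≡+ t
    case (no 2∤)  rewrite alternating-odd (edgeCount C) 2∤ | odd C isC 2∤ = begin
      opposite (t ⊗ opposite t)    ≡⟨ cong opposite (⊗-opposite t t) ⟩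
      opposite (opposite (t ⊗ t))  ≡⟨ opposite-involutive _ ⟩
      t ⊗ t                        ≡⟨ s*s≡+ t ⟩
      ⊕                            ∎

  -- Balance writes -σ(uv)σ(φu φv) as θ(u)θ(v); solving for -σ(φu φv) gives the similarity.
  weakAut⇒similar : Connected G → IsWeakAut Γ φ → ∃[ θ ] Similar Γ (neg Γ) (φ ⟨$⟩ʳ_) θ
  weakAut⇒similar conn wa with balanced (distortion (IsWeakAut.isAut wa)) (distortion-positive wa) conn
  ... | θ , σ≡ = θ , similar λ u v → entry-cong {s = σ u v} (θ u ⊗ θ v)
    (Equivalence.to (isAut u v)) (Equivalence.from (isAut u v)) λ e e′ →
      ⊗-transpose (σ u v e) (begin
        θ u ⊗ θ v                                         ≡⟨ σ≡ u v e ⟨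
        opposite (σ u v e ⊗ σ _ _ (Equivalence.to (isAut u v) e))
          ≡⟨ cong (λ e″ → opposite (σ u v e ⊗ σ _ _ e″)) (T-irrelevant _ e′) ⟩
        opposite (σ u v e ⊗ σ _ _ e′)                     ≡⟨ cong opposite (*-comm (σ u v e) _) ⟩
        opposite (σ _ _ e′ ⊗ σ u v e)                     ≡⟨ opposite-⊗ (σ _ _ e′) _ ⟨
        opposite (σ _ _ e′) ⊗ σ u v e                     ∎)
    where open IsWeakAut wa

  -- The similarity makes the distortion a coboundary, hence positive on closed walks; this
  -- determines the sign of the image from the sign and the parity of the walk.
  similar⇒weakAut : ∀ {θ} → Similar Γ (neg Γ) (φ ⟨$⟩ʳ_) θ → IsWeakAut Γ φ
  similar⇒weakAut {θ} p = record
    { isAut = aut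
    ; odd   = λ C _ 2∤ → trans (image-sign C) (cong (_⊗ walkSign Γ C) (alternating-odd (edgeCount C) 2∤))
    ; even  = λ C _ 2∣ → trans (image-sign C) (cong (_⊗ walkSign Γ C) (alternating-even (edgeCount C) 2∣))
    }
    where
    aut : IsAut G φ
    aut = similar⇒graphIso φ p
    σ≡ : ∀ u v e → SignedGraph.σ (distortion aut) u v e ≡ θ u ⊗ θ v
    σ≡ u v e = begin
      opposite (σ u v e ⊗ s′)        ≡⟨ ⊗-opposite (σ u v e) s′ ⟨
      σ u v e ⊗ opposite s′          ≡⟨ *-comm (σ u v e) _ ⟩
      opposite s′ ⊗ σ u v e
        ≡⟨ ⊗-transpose (σ u v e) (entry-sign (θ u ⊗ θ v) (apply p u v) e (Equivalence.to (aut u v) e)) ⟨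
      θ u ⊗ θ v                      ∎
      where s′ = σ _ _ (Equivalence.to (aut u v) e)
    image-sign : ∀ {v} (C : Walk G v v) →
                 walkSign Γ (imageWalk G G φ aut C) ≡ alternating (edgeCount C) ⊗ walkSign Γ C
    image-sign {v} C = sym (⊗-cancelled (begin
      (alternating (edgeCount C) ⊗ walkSign Γ C) ⊗ walkSign Γ (imageWalk G G φ aut C)
        ≡⟨ *-assoc (alternating (edgeCount C)) _ _ ⟩
      alternating (edgeCount C) ⊗ (walkSign Γ C ⊗ walkSign Γ (imageWalk G G φ aut C))
        ≡⟨ walkSign-distortion aut C ⟨
      walkSign (distortion aut) C
        ≡⟨ walkSign-coboundary (distortion aut) θ σ≡ C ⟩
      θ v ⊗ θ v
        ≡⟨ s*s≡+ (θ v) ⟩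
      ⊕ ∎))

-- Weak automorphisms of order two in connected graphs.

module _ {n} {G : Graph n} (connected : Connected G) (Γ : SignedGraph G) where
  open SignedGraph Γ

  weakAut-nontrivial : ¬ Bipartite G → ∀ {φ} → IsWeakAut Γ φ → ¬ (∀ v → φ ⟨$⟩ʳ v ≡ v)
  weakAut-nontrivial nonBipartite {φ} wa φ≗id with weakAut⇒similar Γ φ connected wa
  ... | θ , p = nonBipartite (isNegative ∘ θ , λ u v e same → s≢opposite[s] (σ u v e) (sym (begin
    opposite (σ u v e)
      ≡⟨ entry-sign (θ u ⊗ θ v)
           (trans (cong₂ (adjacencyMatrix (neg Γ)) (sym (φ≗id u)) (sym (φ≗id v))) (apply p u v)) e e ⟩
    (θ u ⊗ θ v) ⊗ σ u v e      ≡⟨ cong (λ s → (s ⊗ θ v) ⊗ σ u v e) (isNegative-injective same) ⟩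
    (θ v ⊗ θ v) ⊗ σ u v e      ≡⟨ cong (_⊗ σ u v e) (s*s≡+ (θ v)) ⟩
    σ u v e                    ∎)))
    where
    isNegative-injective : ∀ {s t} → isNegative s ≡ isNegative t → s ≡ t
    isNegative-injective {s} {t} eq =
      trans (sym (sideSign-isNegative s)) (trans (cong sideSign eq) (sideSign-isNegative t))

  module _ {φ : Fin n → Fin n} {θ} (φ-involutive : ∀ v → φ (φ v) ≡ v) (p : Similar Γ (neg Γ) φ θ) where

    -- Applying φ twice shows that v ↦ θ (φ v) ⊗ θ v is constant; at a fixed vertex it is ⊕.
    θ-invariant : ∀ {x} → φ x ≡ x → ∀ v → θ (φ v) ≡ θ v
    θ-invariant {x} φx≡x v = ⊗-cancelled (begin
      κ v            ≡⟨ κ-walk (connected v x) ⟩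
      κ x            ≡⟨ cong (λ y → θ y ⊗ θ x) φx≡x ⟩
      θ x ⊗ θ x      ≡⟨ s*s≡+ (θ x) ⟩
      ⊕              ∎)
      where
      κ : Fin n → Sign
      κ v = θ (φ v) ⊗ θ v
      κ-edge : ∀ u v → Graph._~_ G u v → κ u ≡ κ v
      κ-edge u v e = ⊗-cancelled (begin
        κ u ⊗ κ v
          ≡⟨ ⊗-transpose (σ u v e) (entry-sign (κ u ⊗ κ v) eq e e) ⟩
        opposite (opposite (σ u v e)) ⊗ σ u v e   ≡⟨ cong (_⊗ σ u v e) (opposite-involutive (σ u v e)) ⟩
        σ u v e ⊗ σ u v e                         ≡⟨ s*s≡+ (σ u v e) ⟩
        ⊕                                         ∎)
        where
        eq = trans (cong₂ (adjacencyMatrix (neg (neg Γ))) (sym (φ-involutive u)) (sym (φ-involutive v)))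
                   (apply (similar-trans p (similar-neg p)) u v)
      κ-walk : ∀ {u v} → Walk G u v → κ u ≡ κ v
      κ-walk ε       = refl
      κ-walk (e ◅ w) = trans (κ-edge _ _ e) (κ-walk w)

  -- The one similarity yields both the sign-symmetry and the weak automorphism. Order 2 is minimal
  -- because a weak automorphism of order 1 would be the identity.
  involution⇒𝔽𝕊₁ : ¬ Bipartite G → ∀ (φ : Permutation′ n) {θ} → (∀ v → φ ⟨$⟩ʳ (φ ⟨$⟩ʳ v) ≡ v) →
                   ∃[ v ] φ ⟨$⟩ʳ v ≢ v → ∃[ v ] φ ⟨$⟩ʳ v ≡ v → Similar Γ (neg Γ) (φ ⟨$⟩ʳ_) θ → 𝔽𝕊₁ G Γ
  involution⇒𝔽𝕊₁ nonBipartite φ φ-involutive (w , φw≢w) fixed p =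
    (similar⇒≃ φ p , φ , principal) , φ , principal , fixed
    where
    principal : IsPrincipalOfOrder Γ φ 2
    principal = record
      { isWeakAut = similar⇒weakAut Γ φ p
      ; hasOrder  = record
        { positive = s≤s z≤n
        ; power    = φ-involutive
        ; least    = λ { (suc zero) _ φ≗id → contradiction (φ≗id w) φw≢w ; (suc (suc _)) _ _ → s≤s (s≤s z≤n) }
        }
      ; minimal = λ { ψ zero _ o → contradiction (HasOrder.positive o) λ ()
                    ; ψ (suc zero) wa o → contradiction (HasOrder.power o) (weakAut-nontrivial nonBipartite wa)
                    ; ψ (suc (suc _)) _ _ → s≤s (s≤s z≤n) }
      }

-- From a block form to an involution

module _ {n} {G : Graph n} {Γ : SignedGraph G} (form : BlockForm Γ) where
  open BlockForm form renaming (m to lows)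
  private
    Pos : Set
    Pos = Position a b s r

  swap : Pos → Pos
  swap (ω₁ x)   = ω₁ x
  swap (ω₂ x)   = ω₂ x
  swap (u₁ j x) = u₂ j x
  swap (u₂ j x) = u₁ j x

  swap-involutive : ∀ p → swap (swap p) ≡ p
  swap-involutive (ω₁ x)   = refl
  swap-involutive (ω₂ x)   = refl
  swap-involutive (u₁ j x) = refl
  swap-involutive (u₂ j x) = refl

  blockSign : Fin s → Sign
  blockSign j = if does (toℕ j ℕ.<? lows) then ⊖ else ⊕

  blockSign-cases : ∀ j → (toℕ j ℕ.< lows × blockSign j ≡ ⊖) ⊎ (lows ≤ toℕ j × blockSign j ≡ ⊕)
  blockSign-cases j with toℕ j ℕ.<? lows
  ... | yes low  = inj₁ (low , cong (if_then ⊖ else ⊕) (dec-true (toℕ j ℕ.<? lows) low))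
  ... | no  ¬low = inj₂ (ℕ.≮⇒≥ ¬low , cong (if_then ⊖ else ⊕) (dec-false (toℕ j ℕ.<? lows) ¬low))

  -- Chosen so that `swap` reverses `Γ`: it keeps the entries between Ω₁ and Ω₂, so these get
  -- opposite signs; it keeps the entries from Ω₁ to low blocks and negates those to high blocks, so
  -- low blocks get the sign opposite to Ω₁ and high blocks the same.
  charge : Pos → Sign
  charge (ω₁ _)   = ⊕
  charge (ω₂ _)   = ⊖
  charge (u₁ j _) = blockSign j
  charge (u₂ j _) = blockSign j

  Reverses : Pos → Pos → Set
  Reverses p q = - M (swap p) (swap q) ≡ (charge p ⊗ charge q) · M p q

  reverses-sym : ∀ p q → Reverses p q → Reverses q p
  reverses-sym p q eq = begin
    - M (swap q) (swap p)         ≡⟨ cong -_ (adjacencyMatrix-sym Γ _ _) ⟩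
    - M (swap p) (swap q)         ≡⟨ eq ⟩
    (charge p ⊗ charge q) · M p q
      ≡⟨ cong₂ _·_ (*-comm (charge p) (charge q)) (sym (adjacencyMatrix-sym Γ _ _)) ⟩
    (charge q ⊗ charge p) · M q p ∎

  reverses-zero : ∀ {x y} s → x ≡ 0ℤ → y ≡ 0ℤ → - x ≡ s · y
  reverses-zero ⊕ refl refl = refl
  reverses-zero ⊖ refl refl = refl

  reverses-diagonal : ∀ j {x y} → - x ≡ y → - x ≡ (blockSign j ⊗ blockSign j) · y
  reverses-diagonal j eq rewrite s*s≡+ (blockSign j) = eq

  double-neg : ∀ {x y z} → x ≡ z → y ≡ - z → - y ≡ x
  double-neg {z = z} refl refl = neg-involutive z

  -- Within one index `j` the two block signs cancel, and what remains is that exchanging the halves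
  -- negates `B` and `Y`. Between different indices both sides vanish.
  reverses : ∀ p q → Reverses p q
  reverses (ω₁ x) (ω₁ y) = reverses-zero ⊕ (Ω₁Ω₁ x y) (Ω₁Ω₁ x y)
  reverses (ω₂ x) (ω₂ y) = reverses-zero ⊕ (Ω₂Ω₂ x y) (Ω₂Ω₂ x y)
  reverses (ω₁ x) (ω₂ y) = refl
  reverses (ω₂ x) (ω₁ y) = refl
  reverses (ω₁ x) (u₁ j y) with blockSign-cases j
  ... | inj₁ (low , eq)  rewrite eq = cong -_ (trans (low-Ω₁U₂ j low x y) (sym (low-Ω₁U₁ j low x y)))
  ... | inj₂ (high , eq) rewrite eq = double-neg (high-Ω₁U₁ j high x y) (high-Ω₁U₂ j high x y)
  reverses (ω₁ x) (u₂ j y) with blockSign-cases j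
  ... | inj₁ (low , eq)  rewrite eq = cong -_ (trans (low-Ω₁U₁ j low x y) (sym (low-Ω₁U₂ j low x y)))
  ... | inj₂ (high , eq) rewrite eq = trans (cong -_ (high-Ω₁U₁ j high x y)) (sym (high-Ω₁U₂ j high x y))
  reverses (ω₂ x) (u₁ j y) with blockSign-cases j
  ... | inj₁ (low , eq)  rewrite eq = double-neg (low-Ω₂U₁ j low x y) (low-Ω₂U₂ j low x y)
  ... | inj₂ (high , eq) rewrite eq = cong -_ (trans (high-Ω₂U₂ j high x y) (sym (high-Ω₂U₁ j high x y)))
  reverses (ω₂ x) (u₂ j y) with blockSign-cases j
  ... | inj₁ (low , eq)  rewrite eq = trans (cong -_ (low-Ω₂U₁ j low x y)) (sym (low-Ω₂U₂ j low x y))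
  ... | inj₂ (high , eq) rewrite eq = cong -_ (trans (high-Ω₂U₁ j high x y) (sym (high-Ω₂U₂ j high x y)))
  reverses (u₁ j x) (u₁ k y) with j ≟ k
  ... | no j≢k   = reverses-zero (blockSign j ⊗ blockSign k) (off-U₂U₂ j k j≢k x y) (off-U₁U₁ j k j≢k x y)
  ... | yes refl = reverses-diagonal j (double-neg (U₁U₁ j x y) (U₂U₂ j x y))
  reverses (u₁ j x) (u₂ k y) with j ≟ k
  ... | no j≢k   = reverses-zero (blockSign j ⊗ blockSign k) (off-U₂U₁ j k j≢k x y) (off-U₁U₂ j k j≢k x y)
  ... | yes refl = reverses-diagonal j (double-neg (U₁U₂ j x y) (U₂U₁ j x y))
  reverses (u₂ j x) (u₂ k y) with j ≟ k
  ... | no j≢k   = reverses-zero (blockSign j ⊗ blockSign k) (off-U₁U₁ j k j≢k x y) (off-U₂U₂ j k j≢k x y)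
  ... | yes refl = reverses-diagonal j (trans (cong -_ (U₁U₁ j x y)) (sym (U₂U₂ j x y)))
  -- The remaining blocks are transposes of blocks above.
  reverses (u₁ j x) p@(ω₁ _)   = reverses-sym p (u₁ j x) (reverses p (u₁ j x))
  reverses (u₁ j x) p@(ω₂ _)   = reverses-sym p (u₁ j x) (reverses p (u₁ j x))
  reverses (u₂ j x) p@(ω₁ _)   = reverses-sym p (u₂ j x) (reverses p (u₂ j x))
  reverses (u₂ j x) p@(ω₂ _)   = reverses-sym p (u₂ j x) (reverses p (u₂ j x))
  reverses (u₂ j x) p@(u₁ _ _) = reverses-sym p (u₂ j x) (reverses p (u₂ j x))

  blockSwap : Permutation′ n
  blockSwap = permutation f f f-involutive f-involutive
    where
    f : Fin n → Fin n
    f = Inverse.to place ∘ swap ∘ Inverse.from place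
    f-involutive : ∀ v → f (f v) ≡ v
    f-involutive v = begin
      Inverse.to place (swap (Inverse.from place (f v)))
        ≡⟨ cong (Inverse.to place ∘ swap) (Inverse.strictlyInverseʳ place _) ⟩
      Inverse.to place (swap (swap (Inverse.from place v)))
        ≡⟨ cong (Inverse.to place) (swap-involutive _) ⟩
      Inverse.to place (Inverse.from place v)             ≡⟨ Inverse.strictlyInverseˡ place v ⟩
      v                                                   ∎

  blockSwap-similar : Similar Γ (neg Γ) (blockSwap ⟨$⟩ʳ_) (charge ∘ Inverse.from place)
  blockSwap-similar = similar λ u v → let p = Inverse.from place u ; q = Inverse.from place v in begin
    adjacencyMatrix (neg Γ) (blockSwap ⟨$⟩ʳ u) (blockSwap ⟨$⟩ʳ v)
      ≡⟨ adjacencyMatrix-neg Γ _ _ ⟩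
    - M (swap p) (swap q)
      ≡⟨ reverses p q ⟩
    (charge p ⊗ charge q) · M p q
      ≡⟨ cong₂ (λ x y → (charge p ⊗ charge q) · adjacencyMatrix Γ x y)
           (Inverse.strictlyInverseˡ place u) (Inverse.strictlyInverseˡ place v) ⟩
    (charge p ⊗ charge q) · adjacencyMatrix Γ u v ∎

  blockSwap-place : ∀ p → blockSwap ⟨$⟩ʳ Inverse.to place p ≡ Inverse.to place (swap p)
  blockSwap-place p = cong (Inverse.to place ∘ swap) (Inverse.strictlyInverseʳ place p)

  place-injective : ∀ {p q} → Inverse.to place p ≡ Inverse.to place q → p ≡ q
  place-injective {p} {q} eq = begin
    p                                          ≡⟨ Inverse.strictlyInverseʳ place p ⟨
    Inverse.from place (Inverse.to place p)    ≡⟨ cong (Inverse.from place) eq ⟩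
    Inverse.from place (Inverse.to place q)    ≡⟨ Inverse.strictlyInverseʳ place q ⟩
    q                                          ∎

  blockSwap-moves : ∃[ v ] blockSwap ⟨$⟩ʳ v ≢ v
  blockSwap-moves = Inverse.to place p , λ eq →
    contradiction (place-injective (trans (sym (blockSwap-place p)) eq)) λ ()
    where
    j = fromℕ< 1≤s
    p : Pos
    p = u₁ j (fromℕ< (U-nonempty j))

  blockSwap-fixes : ∃[ v ] blockSwap ⟨$⟩ʳ v ≡ v
  blockSwap-fixes with splitAt a (fromℕ< Ω-nonempty)
  ... | inj₁ x = Inverse.to place (ω₁ x) , blockSwap-place (ω₁ x)
  ... | inj₂ x = Inverse.to place (ω₂ x) , blockSwap-place (ω₂ x)

-- From an involution to a block form

module Enumeration {n} {P : Fin n → Set} (P? : Decidable P) where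

  -- The blocks of a `BlockForm` are indexed by some `Fin k`, so a block given by a property is
  -- numbered by listing its vertices in increasing order.
  elements : List (Fin n)
  elements = filter P? (allFin n)

  size : ℕ
  size = length elements

  nth : Fin size → Fin n
  nth = List.lookup elements

  nth-satisfies : ∀ i → P (nth i)
  nth-satisfies i = proj₂ (∈-filter⁻ P? {xs = allFin n} (∈-lookup i))

  rankOf : ∀ {v} → P v → Fin size
  rankOf {v} pv = index (∈-filter⁺ P? (∈-allFin v) pv)

  nth-rankOf : ∀ {v} (pv : P v) → nth (rankOf pv) ≡ v
  nth-rankOf {v} pv = sym (lookup-index (∈-filter⁺ P? (∈-allFin v) pv))

  lookup-injective : ∀ {xs : List (Fin n)} → Unique xs →
                     ∀ i j → List.lookup xs i ≡ List.lookup xs j → i ≡ j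
  lookup-injective (x∉ ∷ !xs) zero    zero    eq = refl
  lookup-injective (x∉ ∷ !xs) zero    (suc j) eq = contradiction eq (All.lookup x∉ (∈-lookup j))
  lookup-injective (x∉ ∷ !xs) (suc i) zero    eq = contradiction (sym eq) (All.lookup x∉ (∈-lookup i))
  lookup-injective (x∉ ∷ !xs) (suc i) (suc j) eq = cong suc (lookup-injective !xs i j eq)

  nth-injective : ∀ i j → nth i ≡ nth j → i ≡ j
  nth-injective = lookup-injective (filter⁺ P? (allFin⁺ n))

-- For the blocks Ω₁ × Ω₁ and Ω₂ × Ω₂, where `φ` fixes the position of an entry and the reversal
-- negates its value.
self-negative : ∀ {x} → x ≡ - x → x ≡ 0ℤ
self-negative {+ zero} _ = refl

inhabited⇒positive : Fin n → 1 ≤ n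
inhabited⇒positive {suc _} _ = s≤s z≤n

-- With θ trivial off the fixed vertices, a single pair U₁, U₂ (s = m = 1) suffices.
module _ {n} {G : Graph n} {Γ : SignedGraph G} {φ : Fin n → Fin n} {θ : Fin n → Sign}
         (φ-involutive : ∀ v → φ (φ v) ≡ v) (θ-moved : ∀ v → φ v ≢ v → θ v ≡ ⊕)
         (p : Similar Γ (neg Γ) φ θ) where
  private
    -- The low pattern decides which sign is Ω₁: as `θ` is trivial on moved vertices, a fixed vertex
    -- of sign `⊖` has equal entries to both members of a 2-cycle.
    module Ω₁ = Enumeration (λ v → (φ v ≟ v) ×-dec (θ v Sign.≟ ⊖))
    module Ω₂ = Enumeration (λ v → (φ v ≟ v) ×-dec (θ v Sign.≟ ⊕))
    -- Each 2-cycle of `φ` is represented by its smaller vertex.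
    module U  = Enumeration (λ v → v <? φ v)

    Pos : Set
    Pos = Position Ω₁.size Ω₂.size 1 (λ _ → U.size)

  vertexAt : Pos → Fin n
  vertexAt (ω₁ x)   = Ω₁.nth x
  vertexAt (ω₂ x)   = Ω₂.nth x
  vertexAt (u₁ j x) = U.nth x
  vertexAt (u₂ j x) = φ (U.nth x)

  φ-injective : ∀ {u v} → φ u ≡ φ v → u ≡ v
  φ-injective {u} {v} eq = trans (sym (φ-involutive u)) (trans (cong φ eq) (φ-involutive v))

  Ω₁≢Ω₂ : ∀ x y → Ω₁.nth x ≢ Ω₂.nth y
  Ω₁≢Ω₂ x y eq with trans (sym (proj₂ (Ω₁.nth-satisfies x))) (trans (cong θ eq) (proj₂ (Ω₂.nth-satisfies y)))
  ... | ()

  fixed≢U₁ : ∀ {v} x → φ v ≡ v → v ≢ U.nth x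
  fixed≢U₁ x φv≡v refl = <-irrefl (sym φv≡v) (U.nth-satisfies x)

  fixed≢U₂ : ∀ {v} x → φ v ≡ v → v ≢ φ (U.nth x)
  fixed≢U₂ x φv≡v refl = fixed≢U₁ x φv≡v (trans (sym φv≡v) (φ-involutive _))

  -- Otherwise both members of one 2-cycle would be its smaller vertex.
  U₁≢U₂ : ∀ x y → U.nth x ≢ φ (U.nth y)
  U₁≢U₂ x y eq = <-asym (U.nth-satisfies y)
    (subst₂ _<_ eq (trans (cong φ eq) (φ-involutive (U.nth y))) (U.nth-satisfies x))

  vertexAt-injective : ∀ {p q} → vertexAt p ≡ vertexAt q → p ≡ q
  vertexAt-injective {ω₁ x}      {ω₁ y}      eq = cong ω₁ (Ω₁.nth-injective x y eq)
  vertexAt-injective {ω₂ x}      {ω₂ y}      eq = cong ω₂ (Ω₂.nth-injective x y eq)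
  vertexAt-injective {u₁ zero x} {u₁ zero y} eq = cong (u₁ zero) (U.nth-injective x y eq)
  vertexAt-injective {u₂ zero x} {u₂ zero y} eq = cong (u₂ zero) (U.nth-injective x y (φ-injective eq))
  vertexAt-injective {ω₁ x}      {ω₂ y}      eq = contradiction eq (Ω₁≢Ω₂ x y)
  vertexAt-injective {ω₂ x}      {ω₁ y}      eq = contradiction (sym eq) (Ω₁≢Ω₂ y x)
  vertexAt-injective {ω₁ x}      {u₁ _ y}    eq = contradiction eq (fixed≢U₁ y (proj₁ (Ω₁.nth-satisfies x)))
  vertexAt-injective {ω₁ x}      {u₂ _ y}    eq = contradiction eq (fixed≢U₂ y (proj₁ (Ω₁.nth-satisfies x)))
  vertexAt-injective {ω₂ x}      {u₁ _ y}    eq = contradiction eq (fixed≢U₁ y (proj₁ (Ω₂.nth-satisfies x)))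
  vertexAt-injective {ω₂ x}      {u₂ _ y}    eq = contradiction eq (fixed≢U₂ y (proj₁ (Ω₂.nth-satisfies x)))
  vertexAt-injective {u₁ _ x}    {ω₁ y}      eq = contradiction (sym eq) (fixed≢U₁ x (proj₁ (Ω₁.nth-satisfies y)))
  vertexAt-injective {u₁ _ x}    {ω₂ y}      eq = contradiction (sym eq) (fixed≢U₁ x (proj₁ (Ω₂.nth-satisfies y)))
  vertexAt-injective {u₂ _ x}    {ω₁ y}      eq = contradiction (sym eq) (fixed≢U₂ x (proj₁ (Ω₁.nth-satisfies y)))
  vertexAt-injective {u₂ _ x}    {ω₂ y}      eq = contradiction (sym eq) (fixed≢U₂ x (proj₁ (Ω₂.nth-satisfies y)))
  vertexAt-injective {u₁ _ x}    {u₂ _ y}    eq = contradiction eq (U₁≢U₂ x y)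
  vertexAt-injective {u₂ _ x}    {u₁ _ y}    eq = contradiction (sym eq) (U₁≢U₂ y x)

  vertexAt-surjective : ∀ v → ∃[ p ] vertexAt p ≡ v
  vertexAt-surjective v with <-cmp v (φ v) | θ v in θv
  ... | tri< v<φv _ _ | _ = u₁ zero (U.rankOf v<φv) , U.nth-rankOf v<φv
  ... | tri≈ _ v≡φv _ | ⊖ = ω₁ (Ω₁.rankOf (sym v≡φv , θv)) , Ω₁.nth-rankOf (sym v≡φv , θv)
  ... | tri≈ _ v≡φv _ | ⊕ = ω₂ (Ω₂.rankOf (sym v≡φv , θv)) , Ω₂.nth-rankOf (sym v≡φv , θv)
  ... | tri> _ _ φv<v | _ = u₂ zero (U.rankOf φv<φφv) , trans (cong φ (U.nth-rankOf φv<φφv)) (φ-involutive v)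
    where φv<φφv = subst (φ v <_) (sym (φ-involutive v)) φv<v

  place : Pos ↔ Fin n
  place = mk↔ₛ′ vertexAt (proj₁ ∘ vertexAt-surjective) (proj₂ ∘ vertexAt-surjective)
    (λ p → vertexAt-injective (proj₂ (vertexAt-surjective (vertexAt p))))

  θ-U₁ : ∀ x → θ (U.nth x) ≡ ⊕
  θ-U₁ x = θ-moved _ λ eq → <-irrefl (sym eq) (U.nth-satisfies x)

  θ-U₂ : ∀ x → θ (φ (U.nth x)) ≡ ⊕
  θ-U₂ x = θ-moved _ λ eq → <-irrefl (sym (φ-injective eq)) (U.nth-satisfies x)

  -- The similarity to `neg Γ` as a relation between entries of `Γ` alone; each block supplies its
  -- known values of `θ` and `φ`.
  reversal : ∀ {u v s t u′ v′} → θ u ≡ s → θ v ≡ t → φ u ≡ u′ → φ v ≡ v′ →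
             adjacencyMatrix Γ u′ v′ ≡ opposite (s ⊗ t) · adjacencyMatrix Γ u v
  reversal {u} {v} {s} {t} refl refl refl refl = begin
    adjacencyMatrix Γ (φ u) (φ v)              ≡⟨ neg-involutive _ ⟨
    - - adjacencyMatrix Γ (φ u) (φ v)          ≡⟨ cong -_ (adjacencyMatrix-neg Γ (φ u) (φ v)) ⟨
    - adjacencyMatrix (neg Γ) (φ u) (φ v)      ≡⟨ cong -_ (apply p u v) ⟩
    - ((s ⊗ t) · adjacencyMatrix Γ u v)        ≡⟨ neg-· (s ⊗ t) _ ⟩
    opposite (s ⊗ t) · adjacencyMatrix Γ u v   ∎

  blockForm : ∃[ v ] φ v ≢ v → ∃[ v ] φ v ≡ v → BlockForm Γ
  blockForm (w , φw≢w) (z , φz≡z) = record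
    { s = 1 ; m = 1 ; 1≤s = s≤s z≤n ; m≤s = s≤s z≤n
    ; a = Ω₁.size ; b = Ω₂.size ; r = λ _ → U.size
    ; Ω-nonempty = Ω-size
    ; U-nonempty = λ _ → U-size
    ; place = place
    ; A  = λ x y → M′ (ω₁ x) (ω₂ y)
    ; D₁ = λ j x y → M′ (ω₁ x) (u₁ j y)
    ; D₂ = λ j x y → M′ (ω₂ x) (u₁ j y)
    ; B  = λ j x y → M′ (u₁ j x) (u₁ j y)
    ; Y  = λ j x y → M′ (u₁ j x) (u₂ j y)
    ; A-sign  = λ x y → M′-sign (ω₁ x) (ω₂ y)
    ; D₁-sign = λ j x y → M′-sign (ω₁ x) (u₁ j y)
    ; D₂-sign = λ j x y → M′-sign (ω₂ x) (u₁ j y)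
    ; B-sign  = λ j x y → M′-sign (u₁ j x) (u₁ j y)
    ; Y-sign  = λ j x y → M′-sign (u₁ j x) (u₂ j y)
    ; B-symmetric    = λ j x y → M′-sym (u₁ j x) (u₁ j y)
    ; B-zeroDiagonal = λ j x → loopless (U.nth x)
    -- By symmetry the transposed entry of `Y` lies in the block U₂ × U₁, which the reversal
    -- identifies with -`Y`.
    ; Y-skew = λ j x y → trans (M′-sym (u₂ j x) (u₁ j y)) (U₂U₁ x y)
    ; Ω₁Ω₁ = λ x y → self-negative (reversal (θ-Ω₁ x) (θ-Ω₁ y) (φ-Ω₁ x) (φ-Ω₁ y))
    ; Ω₂Ω₂ = λ x y → self-negative (reversal (θ-Ω₂ x) (θ-Ω₂ y) (φ-Ω₂ x) (φ-Ω₂ y))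
    ; Ω₁Ω₂ = λ x y → refl
    ; low-Ω₁U₁ = λ _ _ x y → refl
    ; low-Ω₁U₂ = λ _ _ x y → reversal (θ-Ω₁ x) (θ-U₁ y) (φ-Ω₁ x) refl
    ; low-Ω₂U₁ = λ _ _ x y → refl
    ; low-Ω₂U₂ = λ _ _ x y → reversal (θ-Ω₂ x) (θ-U₁ y) (φ-Ω₂ x) refl
    -- With `s = m = 1` no index is high, and below no two indices differ.
    ; high-Ω₁U₁ = λ { zero () }
    ; high-Ω₁U₂ = λ { zero () }
    ; high-Ω₂U₁ = λ { zero () }
    ; high-Ω₂U₂ = λ { zero () }
    ; U₁U₁ = λ _ x y → refl
    ; U₁U₂ = λ _ x y → refl
    ; U₂U₁ = λ _ x y → U₂U₁ x y
    ; U₂U₂ = λ _ x y → reversal (θ-U₁ x) (θ-U₁ y) refl refl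
    ; off-U₁U₁ = λ { zero zero 0≢0 → contradiction refl 0≢0 }
    ; off-U₁U₂ = λ { zero zero 0≢0 → contradiction refl 0≢0 }
    ; off-U₂U₁ = λ { zero zero 0≢0 → contradiction refl 0≢0 }
    ; off-U₂U₂ = λ { zero zero 0≢0 → contradiction refl 0≢0 }
    }
    where
    M′ : Pos → Pos → ℤ
    M′ p q = adjacencyMatrix Γ (vertexAt p) (vertexAt q)
    M′-sign : ∀ p q → IsSignEntry (M′ p q)
    M′-sign p q = entry-signEntry (Graph.adjacent G (vertexAt p) (vertexAt q)) _
    M′-sym : ∀ p q → M′ q p ≡ M′ p q
    M′-sym p q = adjacencyMatrix-sym Γ (vertexAt p) (vertexAt q)
    loopless : ∀ v → adjacencyMatrix Γ v v ≡ 0ℤ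
    loopless v with Graph.adjacent G v v | Graph.irreflexive G v | SignedGraph.σ Γ v v
    ... | false | _ | _ = refl
    θ-Ω₁ : ∀ x → θ (Ω₁.nth x) ≡ ⊖
    θ-Ω₁ x = proj₂ (Ω₁.nth-satisfies x)
    θ-Ω₂ : ∀ x → θ (Ω₂.nth x) ≡ ⊕
    θ-Ω₂ x = proj₂ (Ω₂.nth-satisfies x)
    φ-Ω₁ : ∀ x → φ (Ω₁.nth x) ≡ Ω₁.nth x
    φ-Ω₁ x = proj₁ (Ω₁.nth-satisfies x)
    φ-Ω₂ : ∀ x → φ (Ω₂.nth x) ≡ Ω₂.nth x
    φ-Ω₂ x = proj₁ (Ω₂.nth-satisfies x)
    U₂U₁ : ∀ x y → M′ (u₂ zero x) (u₁ zero y) ≡ - M′ (u₁ zero x) (u₂ zero y)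
    U₂U₁ x y = reversal (θ-U₁ x) (θ-U₂ y) refl (φ-involutive (U.nth y))
    Ω-size : 1 ≤ Ω₁.size ℕ.+ Ω₂.size
    Ω-size with θ z in θz
    ... | ⊖ = ℕ.≤-trans (inhabited⇒positive (Ω₁.rankOf (φz≡z , θz))) (ℕ.m≤m+n _ _)
    ... | ⊕ = ℕ.≤-trans (inhabited⇒positive (Ω₂.rankOf (φz≡z , θz))) (ℕ.m≤n+m _ _)
    U-size : 1 ≤ U.size
    U-size with vertexAt-surjective w
    ... | ω₁ x   , refl = contradiction (φ-Ω₁ x) φw≢w
    ... | ω₂ x   , refl = contradiction (φ-Ω₂ x) φw≢w
    ... | u₁ _ x , _    = inhabited⇒positive x
    ... | u₂ _ x , _    = inhabited⇒positive x

-- Switching the signs away from the moved vertices.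

module _ {n} {G : Graph n} {Γ : SignedGraph G} {φ : Fin n → Fin n} {θ : Fin n → Sign}
         (φ-involutive : ∀ v → φ (φ v) ≡ v) (θ-invariant : ∀ v → θ (φ v) ≡ θ v)
         (p : Similar Γ (neg Γ) φ θ) where

  -- Switching at η replaces θ by v ↦ η (φ v) ⊗ (θ v ⊗ η v), so η = θ at one vertex of each
  -- 2-cycle of φ makes it trivial there.
  switch-moved : Σ[ Γ̃ ∈ SignedGraph G ] ∃[ θ̃ ]
                 Γ ≃ Γ̃ × (∀ v → φ v ≢ v → θ̃ v ≡ ⊕) × Similar Γ̃ (neg Γ̃) φ θ̃
  switch-moved = switch U Γ , _ , similar⇒≃ Perm.id back , θ̃-moved ,
    -- From the switched graph back to `Γ`, on to `neg Γ` by `p`, and to the negative of the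
    -- switched graph.
    similar-trans (similar-trans (similar-switch Γ U) p) (similar-neg back)
    where
    η : Fin n → Sign
    -- The smaller vertex of a 2-cycle is the one that takes `θ`; its partner and the fixed vertices
    -- take the default `⊕`.
    η v = if does (v <? φ v) then θ v else ⊕
    U = tabulate (isNegative ∘ η)
    side : ∀ v → sideSign (lookup U v) ≡ η v
    side v = trans (cong sideSign (lookup∘tabulate _ v)) (sideSign-isNegative (η v))
    back : Similar Γ (switch U Γ) id (sideSign ∘ lookup U)
    back = similar-sym Perm.id (similar-switch Γ U)
    η-low : ∀ {v} → v < φ v → η v ≡ θ v
    η-low {v} v< = cong (if_then θ v else ⊕) (dec-true (v <? φ v) v<)
    η-high : ∀ {v} → φ v < v → η v ≡ ⊕
    η-high {v} φv< = cong (if_then θ v else ⊕) (dec-false (v <? φ v) (<-asym φv<))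
    φφ : ∀ {v} → v ≡ φ (φ v)
    φφ {v} = sym (φ-involutive v)
    moved : ∀ v → φ v ≢ v → η (φ v) ⊗ (θ v ⊗ η v) ≡ ⊕
    moved v φv≢v with <-cmp v (φ v)
    ... | tri≈ _ v≡φv _ = contradiction (sym v≡φv) φv≢v
    ... | tri< v<φv _ _ = begin
      η (φ v) ⊗ (θ v ⊗ η v)
        ≡⟨ cong₂ (λ s t → s ⊗ (θ v ⊗ t)) (η-high (subst (_< φ v) φφ v<φv)) (η-low v<φv) ⟩
      θ v ⊗ θ v               ≡⟨ s*s≡+ (θ v) ⟩
      ⊕                       ∎
    ... | tri> _ _ φv<v = begin
      η (φ v) ⊗ (θ v ⊗ η v)
        ≡⟨ cong₂ (λ s t → s ⊗ (θ v ⊗ t)) (η-low (subst (φ v <_) φφ φv<v)) (η-high φv<v) ⟩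
      -- At the larger vertex the switching contributes `θ (φ v)`, which cancels `θ v` only by
      -- invariance.
      θ (φ v) ⊗ (θ v ⊗ ⊕)     ≡⟨ cong₂ _⊗_ (θ-invariant v) (*-identityʳ (θ v)) ⟩
      θ v ⊗ θ v               ≡⟨ s*s≡+ (θ v) ⟩
      ⊕                       ∎
    θ̃-moved : ∀ v → φ v ≢ v → sideSign (lookup U (φ v)) ⊗ (θ v ⊗ sideSign (lookup U v)) ≡ ⊕
    θ̃-moved v φv≢v = trans (cong₂ (λ s t → s ⊗ (θ v ⊗ t)) (side (φ v)) (side v)) (moved v φv≢v)

-- The equivalence with the block form.

order2⇒moves : ∀ {φ : Permutation′ n} → HasOrder φ 2 → ∃[ v ] φ ⟨$⟩ʳ v ≢ v
order2⇒moves {n} {φ} o = ¬∀⟶∃¬ n (λ v → φ ⟨$⟩ʳ v ≡ v) (λ v → (φ ⟨$⟩ʳ v) ≟ v)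
  λ φ≗id → contradiction (HasOrder.least o 1 (s≤s z≤n) φ≗id) λ { (s≤s ()) }

theorem4p5 : (n : ℕ) (G : Graph n) → Connected G → ¬ Bipartite G → (Γ : SignedGraph G) →
    𝔽𝕊₁ G Γ ⇔ (Σ[ k ∈ ℕ ] Σ[ H ∈ Graph k ] Σ[ Γ̃ ∈ SignedGraph H ] (Γ ≃ Γ̃ × BlockForm Γ̃))
theorem4p5 n G connected nonBipartite Γ = mk⇔ to from
  where
  to : 𝔽𝕊₁ G Γ → Σ[ k ∈ ℕ ] Σ[ H ∈ Graph k ] Σ[ Γ̃ ∈ SignedGraph H ] (Γ ≃ Γ̃ × BlockForm Γ̃)
  to (_ , φ , principal , fixed@(_ , φx≡x))
    with weakAut⇒similar Γ φ connected (IsPrincipalOfOrder.isWeakAut principal)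
  ... | θ , p
    with switch-moved φ-involutive (θ-invariant connected Γ φ-involutive p φx≡x) p
    where φ-involutive = HasOrder.power (IsPrincipalOfOrder.hasOrder principal)
  ... | Γ̃ , θ̃ , Γ≃Γ̃ , θ̃-moved , p̃ =
    -- Switching keeps the underlying graph, so `G` itself carries the block form.
    n , G , Γ̃ , Γ≃Γ̃ , blockForm (HasOrder.power order2) θ̃-moved p̃ (order2⇒moves order2) fixed
    where order2 = IsPrincipalOfOrder.hasOrder principal

  from : (Σ[ k ∈ ℕ ] Σ[ H ∈ Graph k ] Σ[ Γ̃ ∈ SignedGraph H ] (Γ ≃ Γ̃ × BlockForm Γ̃)) → 𝔽𝕊₁ G Γ
  from (k , H , Γ̃ , Γ≃Γ̃ , form) with ≃⇒similar Γ≃Γ̃ | blockSwap-moves form | blockSwap-fixes form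
  ... | f , η , q | w , w-moved | x , x-fixed = involution⇒𝔽𝕊₁ connected Γ nonBipartite φ
    φ-involutive
    (f ⟨$⟩ˡ w , λ eq → w-moved (begin
      β ⟨$⟩ʳ w                                  ≡⟨ cong (β ⟨$⟩ʳ_) (inverseʳ f) ⟨
      β ⟨$⟩ʳ (f ⟨$⟩ʳ (f ⟨$⟩ˡ w))                ≡⟨ inverseʳ f ⟨
      f ⟨$⟩ʳ (φ ⟨$⟩ʳ (f ⟨$⟩ˡ w))                ≡⟨ cong (f ⟨$⟩ʳ_) eq ⟩
      f ⟨$⟩ʳ (f ⟨$⟩ˡ w)                         ≡⟨ inverseʳ f ⟩
      w                                         ∎))
    (f ⟨$⟩ˡ x , cong (f ⟨$⟩ˡ_) (trans (cong (β ⟨$⟩ʳ_) (inverseʳ f)) x-fixed))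
    -- The path from `Γ` to `Γ̃`, across to `neg Γ̃` by the block exchange, and back to `neg Γ`.
    (similar-trans (similar-trans q (blockSwap-similar form)) (similar-neg (similar-sym f q)))
    where
    β : Permutation′ k
    β = blockSwap form
    φ : Permutation′ n
    φ = f ∘ₚ β ∘ₚ flip f
    φ-involutive : ∀ v → φ ⟨$⟩ʳ (φ ⟨$⟩ʳ v) ≡ v
    φ-involutive v = begin
      φ ⟨$⟩ʳ (φ ⟨$⟩ʳ v)                         ≡⟨ cong (λ y → f ⟨$⟩ˡ (β ⟨$⟩ʳ y)) (inverseʳ f) ⟩
      -- `blockSwap` has the same function in both directions, so `inverseˡ` cancels two forward
      -- applications.
      f ⟨$⟩ˡ (β ⟨$⟩ʳ (β ⟨$⟩ʳ (f ⟨$⟩ʳ v)))       ≡⟨ cong (f ⟨$⟩ˡ_) (inverseˡ β) ⟩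
      f ⟨$⟩ˡ (f ⟨$⟩ʳ v)                         ≡⟨ inverseˡ f ⟩
      v                                         ∎
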